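{- Let $F$ be a finite simple graph and let $G$ be a $k$-fold cover of $F$. Then (a) if $F$ is $3$-regular, $\gamma_t(G) \geq \frac{3}{5}\,k\,\gamma_t(F)$; (b) if $F$ is $4$-regular or $5$-regular, $\gamma_t(G) \geq \frac{1}{2}\,k\,\gamma_t(F)$.
   Context: All graphs are finite, simple and undirected. A graph $G$ is a cover of a graph $F$ if there is an onto map $\pi: V(G)\to V(F)$ such that for every vertex $v$ of $G$, $\pi$ maps the neighbours of $v$ in $G$ bijectively onto the neighbours of $\pi(v)$ in $F$; the cover is $k$-fold if every fibre $\pi^{ -1}(u)$ has exactly $k$ vertices. A total dominating set of a graph is a set $S$ of vertices such that every vertex of the graph is adjacent to some vertex of $S$; $\gamma_t(\cdot)$ denotes the total domination number, the minimum size of a total dominating set. -}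

module Defs where

open import Level using (0ℓ)
open import Data.Nat using (ℕ; zero; suc; _≤_; _⊓_)
open import Data.Nat.Properties using (≤-trans; m⊓n≤m; m⊓n≤n; ⊓-sel)
open import Data.Integer using (+_)
open import Data.Rational using (ℚ; _/_)
open import Data.Fin using (Fin; _≟_)
open import Data.Fin.Properties using (all?; any?)
open import Data.Fin.Subset using (Subset; Side; inside; outside; _∈_; ∣_∣; ⊤)
open import Data.Fin.Subset.Properties using (_∈?_; ∈⊤; ∣⊤∣≡n)
open import Data.List using (List; []; _∷_; map; filter; foldr; cartesianProductWith)
open import Data.List.Relation.Unary.Any using (here; there)
import Data.List.Membership.Propositional as L
open import Data.List.Membership.Propositional.Properties using (∈-cartesianProductWith⁺; ∈-map⁺; ∈-map⁻; ∈-filter⁺; ∈-filter⁻)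
import Data.Vec as Vec
open import Data.Product using (_×_; _,_; ∃-syntax)
open import Data.Sum using (_⊎_; inj₁; inj₂)
open import Function.Definitions using (Surjective)
open import Relation.Nullary using (¬_; does)
open import Relation.Nullary.Decidable using (_×-dec_)
import Relation.Unary as U
open import Relation.Binary using (Rel; Decidable; Symmetric)
open import Relation.Binary.PropositionalEquality using (_≡_; refl; sym; trans)

-- Up to isomorphism, the vertex set is Fin order.  Adjacency in a finite graph
-- is given with a decision procedure so that it can be counted.
record Graph : Set₁ where
  field
    order : ℕ
  Vertex : Set
  Vertex = Fin order
  field
    _~_     : Rel Vertex 0ℓ
    _~?_    : Decidable _~_
    ~-sym   : Symmetric _~_
    ~-irref : ∀ v → ¬ (v ~ v)

open Graph public using (order; Vertex)

⟦_⟧ : ∀ {n} {P : U.Pred (Fin n) 0ℓ} → U.Decidable P → Subset n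
⟦ P? ⟧ = Vec.tabulate (λ v → does (P? v))

degree : (G : Graph) → Vertex G → ℕ
degree G v = ∣ ⟦ v ~?_ ⟧ ∣
  where open Graph G

Regular : ℕ → Graph → Set
Regular d G = ∀ v → degree G v ≡ d

record MapsBijectively {A B : Set} (f : A → B) (P : U.Pred A 0ℓ) (Q : U.Pred B 0ℓ) : Set where
  field
    mapsTo      : ∀ {x} → P x → Q (f x)
    injectiveOn : ∀ {x y} → P x → P y → f x ≡ f y → x ≡ y
    onto        : ∀ {z} → Q z → ∃[ x ] P x × f x ≡ z

record IsCover (G F : Graph) (π : Vertex G → Vertex F) : Set where
  private
    module G = Graph G
    module F = Graph F
  field
    surjective : Surjective _≡_ _≡_ π
    neighbours : ∀ v → MapsBijectively π (v G.~_) (π v F.~_)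

fibre : ∀ {m n} → (Fin m → Fin n) → Fin n → Subset m
fibre π u = ⟦ (λ v → π v ≟ u) ⟧

record KFoldCover (k : ℕ) (G F : Graph) : Set where
  field
    π       : Vertex G → Vertex F
    isCover : IsCover G F π
    kFold   : ∀ u → ∣ fibre π u ∣ ≡ k

IsTotalDominating : (G : Graph) → Subset (order G) → Set
IsTotalDominating G S = ∀ v → ∃[ u ] u ∈ S × v ~ u
  where open Graph G

isTotalDominating? : (G : Graph) → U.Decidable (IsTotalDominating G)
isTotalDominating? G S = all? λ v → any? λ u → (u ∈? S) ×-dec (v ~? u)
  where open Graph G

sides : List Side
sides = outside ∷ inside ∷ []

allSubsets : ∀ n → List (Subset n)
allSubsets zero    = Vec.[] ∷ []
allSubsets (suc n) = cartesianProductWith Vec._∷_ sides (allSubsets n)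

-- The initial value order G does not affect the minimum when G has no isolated
-- vertex, since then the whole vertex set is total dominating.  A graph with an
-- isolated vertex has no total dominating set, and γt is then a junk value.
γt : Graph → ℕ
γt G = foldr _⊓_ (order G) (map ∣_∣ (filter (isTotalDominating? G) (allSubsets (order G))))

private
  ∈-allSubsets : ∀ {n} (S : Subset n) → S L.∈ allSubsets n
  ∈-allSubsets Vec.[]             = here refl
  ∈-allSubsets (outside Vec.∷ S) = ∈-cartesianProductWith⁺ Vec._∷_ {xs = sides} (here refl) (∈-allSubsets S)
  ∈-allSubsets (inside Vec.∷ S)  = ∈-cartesianProductWith⁺ Vec._∷_ {xs = sides} (there (here refl)) (∈-allSubsets S)

  foldr-⊓-≤ : ∀ {x} e xs → x L.∈ xs → foldr _⊓_ e xs ≤ x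
  foldr-⊓-≤ e (x ∷ xs) (here refl) = m⊓n≤m x _
  foldr-⊓-≤ e (x ∷ xs) (there p)   = ≤-trans (m⊓n≤n x _) (foldr-⊓-≤ e xs p)

  foldr-⊓-sel : ∀ e xs → foldr _⊓_ e xs ≡ e ⊎ foldr _⊓_ e xs L.∈ xs
  foldr-⊓-sel e []       = inj₁ refl
  foldr-⊓-sel e (x ∷ xs) with ⊓-sel x (foldr _⊓_ e xs) | foldr-⊓-sel e xs
  ... | inj₁ p | _      = inj₂ (here p)
  ... | inj₂ p | inj₁ q = inj₁ (trans p q)
  ... | inj₂ p | inj₂ q rewrite p = inj₂ (there q)

γt-minimal : ∀ G S → IsTotalDominating G S → γt G ≤ ∣ S ∣
γt-minimal G S tds = foldr-⊓-≤ (order G) _ (∈-map⁺ ∣_∣ (∈-filter⁺ (isTotalDominating? G) (∈-allSubsets S) tds))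

γt-attained : ∀ G → let open Graph G using (_~_) in (∀ v → ∃[ u ] v ~ u) → ∃[ S ] IsTotalDominating G S × ∣ S ∣ ≡ γt G
γt-attained G noIsolated
  with foldr-⊓-sel (order G) (map ∣_∣ (filter (isTotalDominating? G) (allSubsets (order G))))
... | inj₁ p = ⊤ , (λ v → let (u , v~u) = noIsolated v in u , ∈⊤ , v~u) , trans (∣⊤∣≡n (order G)) (sym p)
... | inj₂ q with ∈-map⁻ ∣_∣ q
...   | S , S∈ , eq with ∈-filter⁻ (isTotalDominating? G) {xs = allSubsets (order G)} S∈
...     | _ , tds = S , tds , sym eq

fromℕ : ℕ → ℚ
fromℕ n = + n / 1

{-# OPTIONS --safe #-}
module Submission where

-- A total dominating set of a d-regular graph on kn vertices has at least kn/d
-- elements, so it suffices to bound γt(F) by 5n/9, n/2 and 2n/5 for d = 3, 4, 5.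
-- View F as the d-uniform, d-regular hypergraph of its neighbourhoods and let the
-- load of a vertex be the number of its undominated neighbours.  Choose S
-- minimising N|S| + Σ_v g(load v) with g concave and increasing fast enough that
-- adding a vertex of maximum load ≥ 3 lowers the sum; then all loads are at most 2.
-- The undominated vertices are now the nodes, and the vertices of load 2 the edges,
-- of a multigraph of maximum degree d.  A matching M without augmenting paths of
-- length at most 3 meets every edge, and counting gives at most 3d|M|/2 edges.  Taking
-- M and one neighbour of each unmatched node finishes a total dominating set at
-- cost at most (n₁ + 4n₂/3)/d, where nᵢ is the number of vertices of load i.
-- Sets are represented by weight functions Fin n → ℕ; minimisers over these exist
-- up to double negation, which is enough because the bounds are decidable.

open import Defs
open import Data.Nat using (ℕ; zero; suc; z≤n; s≤s; _≤_; _<_; _≤?_)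
import Data.Nat as Nat
open import Data.Nat.Properties as ℕₚ using (+-*-semiring; ≤-refl; ≤-reflexive; ≤-trans; module ≤-Reasoning)
open import Data.Nat.Tactic.RingSolver using (solve-∀)
open import Algebra.Properties.Semiring.Sum +-*-semiring using (sum; sum-syntax; sum-cong-≗; ∑-distrib-+; ∑-comm; *-distribˡ-sum; *-distribʳ-sum)
open import Data.Fin using (Fin; zero; suc; _≟_)
open import Data.Fin.Properties using (any?; all?; ¬∀⟶∃¬)
open import Data.Product using (_×_; _,_; ∃-syntax; proj₁)
open import Data.Sum using (_⊎_; inj₁; inj₂)
open import Data.Empty using (⊥)
open import Data.Bool using (true; false; if_then_else_)
open import Data.Fin.Subset using (Subset; _∈_; ∣_∣)
open import Data.Vec using ([]; _∷_; lookup)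
open import Data.Vec.Properties using ([]=⇒lookup; lookup⇒[]=; lookup∘tabulate)
import Data.Integer as Int
import Data.Integer.Properties as ℤₚ
import Data.Rational.Unnormalised as ℚᵘ
import Data.Rational.Unnormalised.Properties as ℚᵘₚ
import Data.Rational as Rat
import Data.Rational.Properties as ℚₚ
open import Function using (_∘_)
open import Relation.Nullary using (¬_; Dec; yes; no; does; contradiction)
open import Relation.Nullary.Decidable using (from-yes; decidable-stable)
open import Relation.Binary.PropositionalEquality

-- Finite sums, point masses and minimisers in the natural numbers

module Sums where
  open Nat using (_+_; _*_)

  𝟙 : ∀ {P : Set} → Dec P → ℕ
  𝟙 P? = if does P? then 1 else 0

  𝟙≤1 : ∀ {P : Set} (P? : Dec P) → 𝟙 P? ≤ 1
  𝟙≤1 (yes _) = ≤-refl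
  𝟙≤1 (no _)  = z≤n

  𝟙-true : ∀ {P : Set} (P? : Dec P) → P → 𝟙 P? ≡ 1
  𝟙-true (yes _) _ = refl
  𝟙-true (no ¬p) p = contradiction p ¬p

  𝟙-false : ∀ {P : Set} (P? : Dec P) → ¬ P → 𝟙 P? ≡ 0
  𝟙-false (yes p) ¬p = contradiction p ¬p
  𝟙-false (no _)  _  = refl

  𝟙-holds : ∀ {P : Set} (P? : Dec P) → 1 ≤ 𝟙 P? → P
  𝟙-holds (yes p) _ = p

  sum-mono : ∀ {n} {f g : Fin n → ℕ} → (∀ i → f i ≤ g i) → sum f ≤ sum g
  sum-mono {zero}  f≤g = z≤n
  sum-mono {suc n} f≤g = ℕₚ.+-mono-≤ (f≤g zero) (sum-mono (f≤g ∘ suc))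

  sum-const : ∀ n c → ∑[ i < n ] c ≡ n * c
  sum-const zero    c = refl
  sum-const (suc n) c = cong (_+_ c) (sum-const n c)

  sum-*ˡ : ∀ {n} c (f : Fin n → ℕ) → ∑[ i < n ] (c * f i) ≡ c * sum f
  sum-*ˡ c f = sym (*-distribˡ-sum c f)

  sum-positive : ∀ {n} (f : Fin n → ℕ) → 1 ≤ sum f → ∃[ i ] 1 ≤ f i
  sum-positive {suc n} f 1≤ with f zero in eq
  ... | suc _ = zero , subst (1 ≤_) (sym eq) (s≤s z≤n)
  ... | zero  = let (i , p) = sum-positive (f ∘ suc) 1≤ in suc i , p

  -- A Kronecker delta: it serves both as the weight of a single vertex and as the means of
  -- isolating one term of a sum without subtraction.
  point : ∀ {n} → Fin n → Fin n → ℕ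
  point i j = 𝟙 (i ≟ j)

  point-self : ∀ {n} (i : Fin n) → point i i ≡ 1
  point-self i = 𝟙-true (i ≟ i) refl

  sum-point-* : ∀ {n} i (f : Fin n → ℕ) → ∑[ j < n ] (point i j * f j) ≡ f i
  sum-point-* {suc n} zero f = begin
    f zero + 0 + ∑[ j < n ] 0 ≡⟨ cong₂ _+_ (ℕₚ.+-identityʳ (f zero)) (trans (sum-const n 0) (ℕₚ.*-zeroʳ n)) ⟩
    f zero + 0                ≡⟨ ℕₚ.+-identityʳ (f zero) ⟩
    f zero                    ∎
    where open ≡-Reasoning
  sum-point-* {suc n} (suc i) f = trans (sum-cong-≗ λ j → cong (_* f (suc j)) (point-suc i j)) (sum-point-* i (f ∘ suc))
    where
    point-suc : ∀ {n} (i j : Fin n) → point (suc i) (suc j) ≡ point i j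
    point-suc i j with i ≟ j
    ... | yes _ = refl
    ... | no _  = refl

  sum-point : ∀ {n} (i : Fin n) → sum (point i) ≡ 1
  sum-point i = trans (sum-cong-≗ λ j → sym (ℕₚ.*-identityʳ (point i j))) (sum-point-* i (λ _ → 1))

  term≤sum : ∀ {n} (f : Fin n → ℕ) i → f i ≤ sum f
  term≤sum f i = begin
    f i                          ≡⟨ sum-point-* i f ⟨
    sum (λ j → point i j * f j)  ≤⟨ sum-mono (λ j → ℕₚ.*-monoˡ-≤ (f j) (𝟙≤1 (i ≟ j))) ⟩
    sum (λ j → 1 * f j)          ≡⟨ sum-cong-≗ (λ j → ℕₚ.*-identityˡ (f j)) ⟩
    sum f                        ∎
    where open ≤-Reasoning

  -- Three distinct point masses add up to at most 1 everywhere. Applied to a load of at most 2,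
  -- this rules out a third node.
  three-terms≤sum : ∀ {n} (f : Fin n → ℕ) {i j k} → i ≢ j → i ≢ k → j ≢ k → f i + f j + f k ≤ sum f
  three-terms≤sum f {i} {j} {k} i≢j i≢k j≢k = begin
    f i + f j + f k
      ≡⟨ cong₂ _+_ (cong₂ _+_ (sum-point-* i f) (sum-point-* j f)) (sum-point-* k f) ⟨
    sum (λ l → point i l * f l) + sum (λ l → point j l * f l) + sum (λ l → point k l * f l)
      ≡⟨ cong (_+ sum (λ l → point k l * f l)) (∑-distrib-+ (λ l → point i l * f l) (λ l → point j l * f l)) ⟨
    sum (λ l → point i l * f l + point j l * f l) + sum (λ l → point k l * f l)
      ≡⟨ ∑-distrib-+ (λ l → point i l * f l + point j l * f l) (λ l → point k l * f l) ⟨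
    sum (λ l → point i l * f l + point j l * f l + point k l * f l)
      ≤⟨ sum-mono pointwise ⟩
    sum f ∎
    where
    open ≤-Reasoning
    pointwise : ∀ l → point i l * f l + point j l * f l + point k l * f l ≤ f l
    pointwise l with i ≟ l | j ≟ l | k ≟ l
    ... | yes refl | yes refl | _        = contradiction refl i≢j
    ... | yes refl | no _     | yes refl = contradiction refl i≢k
    ... | no _     | yes refl | yes refl = contradiction refl j≢k
    ... | yes _    | no _     | no _     = ≤-reflexive (solve-one (f l))
      where
      solve-one : ∀ x → 1 * x + 0 + 0 ≡ x
      solve-one = solve-∀
    ... | no _     | yes _    | no _     = ≤-reflexive (trans (ℕₚ.+-identityʳ _) (ℕₚ.+-identityʳ _))
    ... | no _     | no _     | yes _    = ≤-reflexive (ℕₚ.+-identityʳ _)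
    ... | no _     | no _     | no _     = z≤n

  -- Meant for a fibre of a cover: by local injectivity it contains at most one neighbour of a given
  -- vertex, so a count over it is bounded by a single term.
  sum-unique-support : ∀ {n} (f : Fin n → ℕ) b → (∀ i → f i ≤ b) →
    (∀ i j → 1 ≤ f i → 1 ≤ f j → i ≡ j) → sum f ≤ b
  sum-unique-support {n} f b f≤b unique with any? (λ i → 1 ≤? f i)
  ... | no none = begin
    sum f                 ≤⟨ sum-mono (λ i → ℕₚ.≤-pred (ℕₚ.≰⇒> λ 1≤ → none (i , 1≤))) ⟩
    sum {n} (λ _ → 0)     ≡⟨ trans (sum-const n 0) (ℕₚ.*-zeroʳ n) ⟩
    0                     ≤⟨ z≤n ⟩
    b                     ∎
    where open ≤-Reasoning
  ... | yes (i , 1≤fi) = begin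
    sum f                          ≤⟨ sum-mono concentrated ⟩
    sum (λ j → point i j * f j)    ≡⟨ sum-point-* i f ⟩
    f i                            ≤⟨ f≤b i ⟩
    b                              ∎
    where
    open ≤-Reasoning
    concentrated : ∀ j → f j ≤ point i j * f j
    concentrated j with i ≟ j
    ... | yes _  = ≤-reflexive (sym (ℕₚ.+-identityʳ _))
    ... | no i≢j = ℕₚ.≤-pred (ℕₚ.≰⇒> λ 1≤ → i≢j (unique i j 1≤fi 1≤))

  -- Under `noMin`, induction on `b` shows that no point has a value below `b`: a point with value
  -- at most `b` and nothing smaller would itself be a minimiser.
  ¬¬-minimiser : ∀ {X : Set} (f : X → ℕ) → X → ¬ ¬ (∃[ x ] ∀ y → f x ≤ f y)
  ¬¬-minimiser {X} f x₀ noMin = noneBelow (suc (f x₀)) x₀ ≤-refl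
    where
    noneBelow : ∀ b x → f x < b → ⊥
    noneBelow (suc b) x (s≤s fx≤b) = noMin (x , λ y → ℕₚ.≮⇒≥ λ fy<fx → noneBelow b y (ℕₚ.<-≤-trans fy<fx fx≤b))

open Sums

isZero isOne isPositive : ℕ → ℕ
isZero zero    = 1
isZero (suc _) = 0
isOne 1 = 1
isOne _ = 0
isPositive zero    = 0
isPositive (suc _) = 1

isZero≤1 : ∀ c → isZero c ≤ 1
isZero≤1 zero    = ≤-refl
isZero≤1 (suc _) = z≤n

isPositive≤ : ∀ c → isPositive c ≤ c
isPositive≤ zero    = z≤n
isPositive≤ (suc _) = s≤s z≤n

-- For non-increasing `δ` this is a concave function vanishing at 0, so concavity reduces to
-- comparing single increments.
prefixSum : (ℕ → ℕ) → ℕ → ℕ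
prefixSum δ zero    = 0
prefixSum δ (suc r) = prefixSum δ r Nat.+ δ r

-- Coverage and load in a regular 0-1 incidence matrix

module Domination {n d : ℕ} (A : Fin n → Fin n → ℕ) (A≤1 : ∀ v u → A v u ≤ 1)
  (row : ∀ v → sum (A v) ≡ d) (column : ∀ u → sum (λ v → A v u) ≡ d) where

  open Nat using (_+_; _*_; _∸_)

  Weight : Set
  Weight = Fin n → ℕ

  -- Counted with multiplicity, which makes it additive in `S`.
  cover : Weight → Weight
  cover S u = ∑[ v < n ] (S v * A v u)

  -- `U` is a parameter since the matching stage works inside the set that the greedy stage leaves
  -- undominated.
  uncovered : Weight → Weight → Weight
  uncovered U S u = U u * isZero (cover S u)

  load : Weight → Weight
  load U v = ∑[ u < n ] (A v u * U u)

  infixl 6 _⊕_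
  _⊕_ : Weight → Weight → Weight
  (S ⊕ T) v = S v + T v

  sum-⊕-point : ∀ S v → sum (S ⊕ point v) ≡ sum S + 1
  sum-⊕-point S v = trans (∑-distrib-+ S (point v)) (cong (sum S +_) (sum-point v))

  cover-⊕ : ∀ S T u → cover (S ⊕ T) u ≡ cover S u + cover T u
  cover-⊕ S T u = trans (sum-cong-≗ λ v → ℕₚ.*-distribʳ-+ (A v u) (S v) (T v)) (∑-distrib-+ (λ v → S v * A v u) (λ v → T v * A v u))

  cover-⊕-point : ∀ S v u → cover (S ⊕ point v) u ≡ cover S u + A v u
  cover-⊕-point S v u = trans (cover-⊕ S (point v) u) (cong (cover S u +_) (sum-point-* v (λ w → A w u)))

  member≤cover : ∀ S v u → 1 ≤ S v → A v u ≤ cover S u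
  member≤cover S v u 1≤Sv = begin
    A v u        ≡⟨ ℕₚ.*-identityˡ (A v u) ⟨
    1 * A v u    ≤⟨ ℕₚ.*-monoˡ-≤ (A v u) 1≤Sv ⟩
    S v * A v u  ≤⟨ term≤sum (λ w → S w * A w u) v ⟩
    cover S u    ∎
    where open ≤-Reasoning

  load-mono : ∀ {U V} → (∀ u → U u ≤ V u) → ∀ v → load U v ≤ load V v
  load-mono U≤V v = sum-mono λ u → ℕₚ.*-monoʳ-≤ (A v u) (U≤V u)

  load-⊕ : ∀ U V v → load (U ⊕ V) v ≡ load U v + load V v
  load-⊕ U V v = trans (sum-cong-≗ λ u → ℕₚ.*-distribˡ-+ (A v u) (U u) (V u)) (∑-distrib-+ (λ u → A v u * U u) (λ u → A v u * V u))

  load-cong : ∀ {U V} → (∀ u → U u ≡ V u) → ∀ v → load U v ≡ load V v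
  load-cong U≡V v = sum-cong-≗ λ u → cong (A v u *_) (U≡V u)

  -- Double counting: each element of `U` lies in `d` neighbourhoods.
  sum-load : ∀ U → sum (load U) ≡ d * sum U
  sum-load U = begin
    ∑[ v < n ] ∑[ u < n ] (A v u * U u)   ≡⟨ ∑-comm (λ v u → A v u * U u) ⟩
    ∑[ u < n ] ∑[ v < n ] (A v u * U u)   ≡⟨ sum-cong-≗ (λ u → *-distribʳ-sum (U u) (λ v → A v u)) ⟨
    ∑[ u < n ] (sum (λ v → A v u) * U u)  ≡⟨ sum-cong-≗ (λ u → cong (_* U u) (column u)) ⟩
    ∑[ u < n ] (d * U u)                  ≡⟨ sum-*ˡ d U ⟩
    d * sum U                             ∎
    where open ≡-Reasoning

  -- Both sides count the adjacent pairs `v`, `u`, weighted by `M v` and `V u`.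
  sum-*-cover : ∀ V M → ∑[ u < n ] (V u * cover M u) ≡ ∑[ v < n ] (M v * load V v)
  sum-*-cover V M = begin
    ∑[ u < n ] (V u * cover M u)                    ≡⟨ sum-cong-≗ (λ u → *-distribˡ-sum (V u) (λ v → M v * A v u)) ⟩
    ∑[ u < n ] ∑[ v < n ] (V u * (M v * A v u))     ≡⟨ ∑-comm (λ u v → V u * (M v * A v u)) ⟩
    ∑[ v < n ] ∑[ u < n ] (V u * (M v * A v u))     ≡⟨ sum-cong-≗ (λ v → sum-cong-≗ λ u → rearrange (V u) (M v) (A v u)) ⟩
    ∑[ v < n ] ∑[ u < n ] (M v * (A v u * V u))     ≡⟨ sum-cong-≗ (λ v → sum-*ˡ (M v) (λ u → A v u * V u)) ⟩
    ∑[ v < n ] (M v * load V v)                     ∎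
    where
    open ≡-Reasoning
    rearrange : ∀ a b c → a * (b * c) ≡ b * (c * a)
    rearrange = solve-∀

  isZero-+ : ∀ a b → isZero (a + b) ≡ isZero a * isZero b
  isZero-+ zero    b = sym (ℕₚ.+-identityʳ (isZero b))
  isZero-+ (suc a) b = refl

  isZero-absorb : ∀ x {a} → a ≤ 1 → x * isZero a + a * x ≡ x
  isZero-absorb x {zero}  _ = trans (ℕₚ.+-identityʳ _) (ℕₚ.*-identityʳ x)
  isZero-absorb x {suc zero} _ = cong₂ _+_ (ℕₚ.*-zeroʳ x) (ℕₚ.+-identityʳ x)
  isZero-absorb x {suc (suc _)} (s≤s ())

  -- Adding `v` removes exactly the uncovered elements adjacent to `v`; the removed part stands on
  -- the left so that no truncated subtraction occurs.
  uncovered-⊕-point : ∀ U S v u → uncovered U (S ⊕ point v) u + A v u * uncovered U S u ≡ uncovered U S u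
  uncovered-⊕-point U S v u = begin
    U u * isZero (cover (S ⊕ point v) u) + A v u * z
      ≡⟨ cong (λ c → U u * isZero c + A v u * z) (cover-⊕-point S v u) ⟩
    U u * isZero (cover S u + A v u) + A v u * z
      ≡⟨ cong (λ c → U u * c + A v u * z) (isZero-+ (cover S u) (A v u)) ⟩
    U u * (isZero (cover S u) * isZero (A v u)) + A v u * z
      ≡⟨ cong (_+ A v u * z) (ℕₚ.*-assoc (U u) _ _) ⟨
    z * isZero (A v u) + A v u * z
      ≡⟨ isZero-absorb z (A≤1 v u) ⟩
    z ∎
    where
    open ≡-Reasoning
    z = uncovered U S u

  idempotent : ∀ v u → A v u * A v u ≡ A v u
  idempotent v u with A v u | A≤1 v u
  ... | zero        | _ = refl
  ... | suc zero    | _ = refl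
  ... | suc (suc _) | s≤s ()

  -- Reduction to load at most 2

  module Greedy (N : ℕ) (δ : ℕ → ℕ) (δ-step : ∀ i → δ (suc i) ≤ δ i) (U : Weight) where

    g : ℕ → ℕ
    g = prefixSum δ

    potential : Weight → ℕ
    potential S = N * sum S + ∑[ v < n ] g (load (uncovered U S) v)

    δ-antitone : ∀ {i j} → i ≤ j → δ j ≤ δ i
    δ-antitone {i} i≤j = go (ℕₚ.≤⇒≤′ i≤j)
      where
      go : ∀ {j} → i Nat.≤′ j → δ j ≤ δ i
      go (Nat.≤′-reflexive refl) = ≤-refl
      go (Nat.≤′-step q) = ≤-trans (δ-step _) (go q)

    -- Each of the `q` increments from `r` on has index at most `Δ`, hence is at least `δ Δ`.
    concave : ∀ Δ r q → r + q ≤ suc Δ → g r + δ Δ * q ≤ g (r + q)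
    concave Δ r zero _ = ≤-reflexive (trans (cong (g r +_) (ℕₚ.*-zeroʳ (δ Δ))) (trans (ℕₚ.+-identityʳ (g r)) (cong g (sym (ℕₚ.+-identityʳ r)))))
    concave Δ r (suc q) r+q≤ = begin
      g r + δ Δ * suc q        ≡⟨ expand (g r) (δ Δ) q ⟩
      g r + δ Δ * q + δ Δ      ≤⟨ ℕₚ.+-mono-≤ (concave Δ r q (ℕₚ.m≤n⇒m≤1+n r+q≤Δ)) (δ-antitone r+q≤Δ) ⟩
      g (r + q) + δ (r + q)    ≡⟨ cong g (sym (ℕₚ.+-suc r q)) ⟩
      g (r + suc q)            ∎
      where
      open ≤-Reasoning
      expand : ∀ a b q → a + b * suc q ≡ a + b * q + b
      expand = solve-∀
      r+q≤Δ : r + q ≤ Δ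
      r+q≤Δ = ℕₚ.≤-pred (subst (_≤ suc Δ) (ℕₚ.+-suc r q) r+q≤)

    module _ (S : Weight) (v₀ : Fin n) where
      private
        z z′ q : Weight
        z  = uncovered U S
        z′ = uncovered U (S ⊕ point v₀)
        q  = load (λ u → A v₀ u * z u)

      -- So `q v` is the amount by which the load of `v` falls when `v₀` is added.
      load-split : ∀ v → load z v ≡ load z′ v + q v
      load-split v = trans (load-cong (λ u → sym (uncovered-⊕-point U S v₀ u)) v) (load-⊕ z′ (λ u → A v₀ u * z u) v)

      decrease-self : q v₀ ≡ load z v₀
      decrease-self = sum-cong-≗ λ u → trans (sym (ℕₚ.*-assoc (A v₀ u) (A v₀ u) (z u))) (cong (_* z u) (idempotent v₀ u))

      -- Adding `v₀` costs `N`. Its own load falls from `suc Δ` to 0, saving `g (suc Δ)`; by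
      -- concavity any other `v` saves at least `δ Δ * q v`. The `q v` sum to `d * suc Δ`, of which
      -- `q v₀` takes `suc Δ`: hence the term added to `N` in the gain hypothesis.
      potential-decreases : ∀ Δ → (∀ v → load z v ≤ suc Δ) → load z v₀ ≡ suc Δ →
        N + δ Δ * suc Δ < δ Δ * (d * suc Δ) + g (suc Δ) → potential (S ⊕ point v₀) < potential S
      potential-decreases Δ load≤ load₀ gain = ℕₚ.+-cancelʳ-< (δ Δ * suc Δ) _ _ (begin-strict
        N * sum (S ⊕ point v₀) + G′ + δ Δ * suc Δ
          ≡⟨ cong (λ s → N * s + G′ + δ Δ * suc Δ) (sum-⊕-point S v₀) ⟩
        N * (sum S + 1) + G′ + δ Δ * suc Δ
          ≡⟨ shuffle N (sum S) G′ (δ Δ * suc Δ) ⟩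
        N * sum S + G′ + (N + δ Δ * suc Δ)
          <⟨ ℕₚ.+-monoʳ-< (N * sum S + G′) gain ⟩
        N * sum S + G′ + (δ Δ * (d * suc Δ) + g (suc Δ))
          ≡⟨ shuffle′ (N * sum S) G′ (δ Δ * (d * suc Δ)) (g (suc Δ)) ⟩
        N * sum S + (G′ + δ Δ * (d * suc Δ) + g (suc Δ))
          ≤⟨ ℕₚ.+-monoʳ-≤ (N * sum S) summed ⟩
        N * sum S + (G + δ Δ * suc Δ)
          ≡⟨ ℕₚ.+-assoc (N * sum S) G (δ Δ * suc Δ) ⟨
        N * sum S + G + δ Δ * suc Δ ∎)
        where
        open ≤-Reasoning
        G G′ : ℕ
        G  = ∑[ v < n ] g (load z v)
        G′ = ∑[ v < n ] g (load z′ v)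
        shuffle : ∀ N s a b → N * (s + 1) + a + b ≡ N * s + a + (N + b)
        shuffle = solve-∀
        shuffle′ : ∀ a b c e → a + b + (c + e) ≡ a + (b + c + e)
        shuffle′ = solve-∀

        load′₀ : load z′ v₀ ≡ 0
        load′₀ = ℕₚ.+-cancelʳ-≡ (q v₀) (load z′ v₀) 0 (trans (sym (load-split v₀)) (sym decrease-self))

        pointwise : ∀ v → g (load z′ v) + δ Δ * q v + point v₀ v * g (suc Δ) ≤ g (load z v) + point v₀ v * (δ Δ * suc Δ)
        pointwise v with v₀ ≟ v
        ... | yes refl = ≤-reflexive (trans (cong₂ (λ a b → g a + δ Δ * b + 1 * g (suc Δ)) load′₀ (trans decrease-self load₀))
                           (trans (swap (δ Δ * suc Δ) (g (suc Δ))) (cong (λ a → g a + 1 * (δ Δ * suc Δ)) (sym load₀))))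
          where
          swap : ∀ a b → a + 1 * b ≡ b + 1 * a
          swap = solve-∀
        ... | no _ = ℕₚ.+-monoˡ-≤ 0 (subst (λ r → g (load z′ v) + δ Δ * q v ≤ g r) (sym (load-split v))
                       (concave Δ (load z′ v) (q v) (subst (_≤ suc Δ) (load-split v) (load≤ v))))

        sum-q : sum q ≡ d * suc Δ
        sum-q = trans (sum-load (λ u → A v₀ u * z u)) (cong (d *_) load₀)

        summed : G′ + δ Δ * (d * suc Δ) + g (suc Δ) ≤ G + δ Δ * suc Δ
        summed = begin
          G′ + δ Δ * (d * suc Δ) + g (suc Δ)
            ≡⟨ cong₂ (λ a b → G′ + δ Δ * a + b) sum-q (sum-point-* v₀ (λ _ → g (suc Δ))) ⟨
          G′ + δ Δ * sum q + sum (λ v → point v₀ v * g (suc Δ))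
            ≡⟨ cong (λ a → G′ + a + sum (λ v → point v₀ v * g (suc Δ))) (sum-*ˡ (δ Δ) q) ⟨
          G′ + sum (λ v → δ Δ * q v) + sum (λ v → point v₀ v * g (suc Δ))
            ≡⟨ cong (_+ sum (λ v → point v₀ v * g (suc Δ))) (∑-distrib-+ (λ v → g (load z′ v)) (λ v → δ Δ * q v)) ⟨
          sum (λ v → g (load z′ v) + δ Δ * q v) + sum (λ v → point v₀ v * g (suc Δ))
            ≡⟨ ∑-distrib-+ (λ v → g (load z′ v) + δ Δ * q v) (λ v → point v₀ v * g (suc Δ)) ⟨
          sum (λ v → g (load z′ v) + δ Δ * q v + point v₀ v * g (suc Δ))
            ≤⟨ sum-mono pointwise ⟩
          sum (λ v → g (load z v) + point v₀ v * (δ Δ * suc Δ))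
            ≡⟨ ∑-distrib-+ (λ v → g (load z v)) (λ v → point v₀ v * (δ Δ * suc Δ)) ⟩
          G + sum (λ v → point v₀ v * (δ Δ * suc Δ))
            ≡⟨ cong (G +_) (sum-point-* v₀ (λ _ → δ Δ * suc Δ)) ⟩
          G + δ Δ * suc Δ ∎

    -- Load values above `b` are excluded one at a time from the top: a vertex attaining the current
    -- maximum could be added with profit.
    minimiser-load≤ : ∀ S → (∀ T → potential S ≤ potential T) → ∀ b j →
      (∀ i → i < j → N + δ (b + i) * suc (b + i) < δ (b + i) * (d * suc (b + i)) + g (suc (b + i))) →
      (∀ v → load (uncovered U S) v ≤ b + j) → ∀ v → load (uncovered U S) v ≤ b
    minimiser-load≤ S minimal b zero gain load≤ v = subst (load (uncovered U S) v ≤_) (ℕₚ.+-identityʳ b) (load≤ v)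
    minimiser-load≤ S minimal b (suc j) gain load≤ =
      minimiser-load≤ S minimal b j (λ i i<j → gain i (ℕₚ.m<n⇒m<1+n i<j)) λ v →
        ℕₚ.≤-pred (ℕₚ.≤∧≢⇒< (load≤′ v) λ load≡ →
          ℕₚ.<⇒≱ (potential-decreases S v (b + j) load≤′ load≡ (gain j ≤-refl)) (minimal (S ⊕ point v)))
      where
      load≤′ : ∀ v → load (uncovered U S) v ≤ suc (b + j)
      load≤′ v = subst (load (uncovered U S) v ≤_) (ℕₚ.+-suc b j) (load≤ v)

  -- Completion by a matching

  -- The completion cost charged to a vertex of given load, scaled by `3 * d`: 1/d for load 1 and
  -- 4/(3d) for load 2.
  matchingWeight : ℕ → ℕ
  matchingWeight 0 = 0
  matchingWeight 1 = 3
  matchingWeight _ = 4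

  module Matching (U : Weight) (load≤2 : ∀ v → load U v ≤ 2) where

    -- The coefficients make a minimiser gain from adding a vertex that covers
    -- two new vertices, and from dropping one that has fewer than two private ones.
    cost : Weight → ℕ
    cost M = 3 * sum M + 2 * sum (uncovered U M)

    module _ (M : Weight) (minimal : ∀ M′ → cost M ≤ cost M′) where
      private
        z : Weight
        z = uncovered U M

      drop : Fin n → Weight
      drop t v = M v ∸ point t v

      -- The truncated subtraction in `drop` is exact because `t` belongs to `M`.
      drop-⊕ : ∀ {t} → 1 ≤ M t → ∀ v → M v ≡ (drop t ⊕ point t) v
      drop-⊕ {t} 1≤ v = sym (ℕₚ.m∸n+n≡m point≤)
        where
        point≤ : point t v ≤ M v
        point≤ with t ≟ v
        ... | yes refl = 1≤
        ... | no _     = z≤n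

      sum-drop : ∀ {t} → 1 ≤ M t → sum M ≡ sum (drop t) + 1
      sum-drop {t} 1≤ = trans (sum-cong-≗ (drop-⊕ 1≤)) (sum-⊕-point (drop t) t)

      cover-drop : ∀ {t} → 1 ≤ M t → ∀ u → cover M u ≡ cover (drop t) u + A t u
      cover-drop {t} 1≤ u = trans (sum-cong-≗ λ v → cong (_* A v u) (drop-⊕ 1≤ v)) (cover-⊕-point (drop t) t u)

      -- Adding a vertex of residual load 2 would cost 3 and save 4. In the multigraph: every edge
      -- has a node covered by `M`.
      residual-load≤1 : ∀ v → load z v ≤ 1
      residual-load≤1 v = ℕₚ.≮⇒≥ λ 1<load → ℕₚ.<-irrefl refl (begin-strict
        3 * sum M + (2 * z′ + 3)            <⟨ ℕₚ.+-monoʳ-< (3 * sum M) (ℕₚ.+-monoʳ-< (2 * z′) (ℕₚ.*-monoʳ-≤ 2 1<load)) ⟩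
        3 * sum M + (2 * z′ + 2 * load z v) ≡⟨ cong (3 * sum M +_) (ℕₚ.*-distribˡ-+ 2 z′ (load z v)) ⟨
        3 * sum M + 2 * (z′ + load z v)     ≡⟨ cong (λ x → 3 * sum M + 2 * x) split ⟩
        cost M                              ≤⟨ minimal (M ⊕ point v) ⟩
        3 * sum (M ⊕ point v) + 2 * z′      ≡⟨ cong (λ s → 3 * s + 2 * z′) (sum-⊕-point M v) ⟩
        3 * (sum M + 1) + 2 * z′            ≡⟨ shuffle (sum M) z′ ⟩
        3 * sum M + (2 * z′ + 3)            ∎)
        where
        open ≤-Reasoning
        z′ : ℕ
        z′ = sum (uncovered U (M ⊕ point v))
        split : z′ + load z v ≡ sum z
        split = trans (sym (∑-distrib-+ (uncovered U (M ⊕ point v)) (λ u → A v u * z u))) (sum-cong-≗ (uncovered-⊕-point U M v))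
        shuffle : ∀ m x → 3 * (m + 1) + 2 * x ≡ 3 * m + (2 * x + 3)
        shuffle = solve-∀

      -- The nodes with a single dominator in `M`, so that `load once t` counts the private
      -- neighbours of a member `t`.
      once : Weight
      once u = U u * isOne (cover M u)

      -- Dropping `t` saves 3 and uncovers only its private neighbours, at a price of 2 each; with
      -- at most one of them this would be profitable.
      private-neighbours≥2 : ∀ t → 1 ≤ M t → 2 ≤ load once t
      private-neighbours≥2 t 1≤ = ℕₚ.≮⇒≥ λ load<2 → ℕₚ.<-irrefl refl (begin-strict
        3 * sum M + 2 * sum z                        ≤⟨ minimal (drop t) ⟩
        3 * μ + 2 * sum (uncovered U (drop t))       ≤⟨ ℕₚ.+-monoʳ-≤ (3 * μ) (ℕₚ.*-monoʳ-≤ 2 (sum-mono pointwise)) ⟩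
        3 * μ + 2 * sum (λ u → z u + A t u * once u) ≡⟨ cong (λ x → 3 * μ + 2 * x) (∑-distrib-+ z (λ u → A t u * once u)) ⟩
        3 * μ + 2 * (sum z + load once t)            ≤⟨ ℕₚ.+-monoʳ-≤ (3 * μ) (ℕₚ.*-monoʳ-≤ 2 (ℕₚ.+-monoʳ-≤ (sum z) (ℕₚ.≤-pred load<2))) ⟩
        3 * μ + 2 * (sum z + 1)                      <⟨ ≤-reflexive (shuffle μ (sum z)) ⟩
        3 * (μ + 1) + 2 * sum z                      ≡⟨ cong (λ s → 3 * s + 2 * sum z) (sum-drop 1≤) ⟨
        3 * sum M + 2 * sum z                        ∎)
        where
        open ≤-Reasoning
        μ : ℕ
        μ = sum (drop t)
        shuffle : ∀ m x → suc (3 * m + 2 * (x + 1)) ≡ 3 * (m + 1) + 2 * x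
        shuffle = solve-∀
        local : ∀ x c {a} → a ≤ 1 → x * isZero c ≤ x * isZero (c + a) + a * (x * isOne (c + a))
        local x c {zero} _ = ≤-trans (≤-reflexive (cong (λ c → x * isZero c) (sym (ℕₚ.+-identityʳ c)))) (ℕₚ.m≤m+n _ 0)
        local x zero {suc zero} _ = ≤-trans (≤-reflexive (sym (ℕₚ.+-identityʳ (x * 1)))) (ℕₚ.m≤n+m _ (x * 0))
        local x (suc c) {suc zero} _ = ≤-trans (≤-reflexive (ℕₚ.*-zeroʳ x)) z≤n
        local x c {suc (suc _)} (s≤s ())
        pointwise : ∀ u → uncovered U (drop t) u ≤ z u + A t u * once u
        pointwise u = subst (λ c → uncovered U (drop t) u ≤ U u * isZero c + A t u * (U u * isOne c))
          (sym (cover-drop 1≤ u)) (local (U u) (cover (drop t) u) (A≤1 t u))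

      -- Private neighbours of different members are distinct, and none of them is a residual node.
      -- Since loads are at most 2, having two private neighbours each makes `M` a matching.
      2*size+residual≤ : 2 * sum M + sum z ≤ sum U
      2*size+residual≤ = begin
        2 * sum M + sum z                          ≡⟨ cong (_+ sum z) (sum-*ˡ 2 M) ⟨
        sum (λ v → 2 * M v) + sum z                ≤⟨ ℕₚ.+-monoˡ-≤ (sum z) (sum-mono twice) ⟩
        sum (λ v → M v * load once v) + sum z      ≡⟨ cong (_+ sum z) (sum-*-cover once M) ⟨
        sum (λ u → once u * cover M u) + sum z     ≡⟨ cong (_+ sum z) (sum-cong-≗ (λ u → isOne-* (U u) (cover M u))) ⟩
        sum once + sum z                           ≡⟨ ∑-distrib-+ once z ⟨
        sum (λ u → once u + z u)                   ≤⟨ sum-mono (λ u → isOne+isZero (U u) (cover M u)) ⟩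
        sum U                                      ∎
        where
        open ≤-Reasoning
        -- Where `once` is nonzero the cover is 1, so the factor `cover M u` changes nothing.
        isOne-* : ∀ x c → x * isOne c * c ≡ x * isOne c
        isOne-* x zero          = trans (ℕₚ.*-zeroʳ (x * 0)) (sym (ℕₚ.*-zeroʳ x))
        isOne-* x (suc zero)    = ℕₚ.*-identityʳ (x * 1)
        isOne-* x (suc (suc c)) = trans (cong (_* suc (suc c)) (ℕₚ.*-zeroʳ x)) (sym (ℕₚ.*-zeroʳ x))
        isOne+isZero : ∀ x c → x * isOne c + x * isZero c ≤ x
        isOne+isZero x zero          = ≤-reflexive (trans (cong (_+ x * 1) (ℕₚ.*-zeroʳ x)) (ℕₚ.*-identityʳ x))
        isOne+isZero x (suc zero)    = ≤-reflexive (trans (cong (x * 1 +_) (ℕₚ.*-zeroʳ x)) (trans (ℕₚ.+-identityʳ (x * 1)) (ℕₚ.*-identityʳ x)))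
        isOne+isZero x (suc (suc _)) = ≤-trans (≤-reflexive (cong₂ _+_ (ℕₚ.*-zeroʳ x) (ℕₚ.*-zeroʳ x))) z≤n
        twice : ∀ v → 2 * M v ≤ M v * load once v
        twice v with M v in eq
        ... | zero  = z≤n
        ... | suc m = ≤-trans (≤-reflexive (ℕₚ.*-comm 2 (suc m))) (ℕₚ.*-monoʳ-≤ (suc m) (private-neighbours≥2 v (subst (1 ≤_) (sym eq) (s≤s z≤n))))

      covered : Weight
      covered u = U u * isPositive (cover M u)

      load-split : ∀ v → load z v + load covered v ≡ load U v
      load-split v = trans (sym (load-⊕ z covered v)) (load-cong (λ u → complement (U u) (cover M u)) v)
        where
        complement : ∀ x c → x * isZero c + x * isPositive c ≡ x
        complement x zero    = trans (cong₂ _+_ (ℕₚ.*-identityʳ x) (ℕₚ.*-zeroʳ x)) (ℕₚ.+-identityʳ x)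
        complement x (suc _) = cong₂ _+_ (ℕₚ.*-zeroʳ x) (ℕₚ.*-identityʳ x)

      covered≤ : ∀ u → covered u ≤ U u * cover M u
      covered≤ u = ℕₚ.*-monoʳ-≤ (U u) (isPositive≤ (cover M u))

      sum-covered≤ : sum covered ≤ 2 * sum M
      sum-covered≤ = begin
        sum covered                   ≤⟨ sum-mono covered≤ ⟩
        sum (λ u → U u * cover M u)   ≡⟨ sum-*-cover U M ⟩
        sum (λ v → M v * load U v)    ≤⟨ sum-mono (λ v → ℕₚ.*-monoʳ-≤ (M v) (load≤2 v)) ⟩
        sum (λ v → M v * 2)           ≡⟨ sum-cong-≗ (λ v → ℕₚ.*-comm (M v) 2) ⟩
        sum (λ v → 2 * M v)           ≡⟨ sum-*ˡ 2 M ⟩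
        2 * sum M                     ∎
        where open ≤-Reasoning

      -- An edge `w` joining an end `v` of the matching edge `t` to an unmatched node `x`.
      record Link (t w v x : Fin n) : Set where
        field
          t~v : 1 ≤ A t v
          w~v : 1 ≤ A w v
          v∈U : 1 ≤ U v
          w~x : 1 ≤ A w x
          x∈z : 1 ≤ z x

      -- Two vertex-disjoint links at t would form an augmenting path x₁ v₁ v₂ x₂:
      -- replacing t by w₁ and w₂ would lower the cost.
      links-meet : ∀ {t w₁ v₁ x₁ w₂ v₂ x₂} → 1 ≤ M t → Link t w₁ v₁ x₁ → Link t w₂ v₂ x₂ → v₁ ≢ v₂ → x₁ ≡ x₂
      links-meet {t} {w₁} {v₁} {x₁} {w₂} {v₂} {x₂} 1≤ l₁ l₂ v₁≢v₂ with x₁ ≟ x₂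
      ... | yes x₁≡x₂ = x₁≡x₂
      ... | no  x₁≢x₂ = contradiction cheaper (ℕₚ.≤⇒≯ (minimal M′))
        where
        open ≤-Reasoning
        module L₁ = Link l₁
        module L₂ = Link l₂
        M₀ M′ : Weight
        M₀ = drop t
        M′ = M₀ ⊕ point w₁ ⊕ point w₂
        cover′ : ∀ u → cover M′ u ≡ cover M₀ u + A w₁ u + A w₂ u
        cover′ u = trans (cover-⊕-point (M₀ ⊕ point w₁) w₂ u) (cong (_+ A w₂ u) (cover-⊕-point M₀ w₁ u))
        cover₁ : ∀ {u} → 1 ≤ A w₁ u → uncovered U M′ u ≡ 0
        cover₁ {u} 1≤A = trans (cong (λ c → U u * isZero c) (cover′ u)) (vanish 1≤A)
          where
          vanish : 1 ≤ A w₁ u → U u * isZero (cover M₀ u + A w₁ u + A w₂ u) ≡ 0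
          vanish p with A w₁ u
          ... | suc a rewrite ℕₚ.+-suc (cover M₀ u) a = ℕₚ.*-zeroʳ (U u)
        cover₂ : ∀ {u} → 1 ≤ A w₂ u → uncovered U M′ u ≡ 0
        cover₂ {u} 1≤A = trans (cong (λ c → U u * isZero c) (cover′ u)) (vanish 1≤A)
          where
          vanish : 1 ≤ A w₂ u → U u * isZero (cover M₀ u + A w₁ u + A w₂ u) ≡ 0
          vanish p with A w₂ u
          ... | suc a rewrite ℕₚ.+-suc (cover M₀ u + A w₁ u) a = ℕₚ.*-zeroʳ (U u)
        -- With `e` the entry `A t u`: either dropping `t` does not affect `u`, or `u` lies outside
        -- `U`.
        elsewhere : ∀ x c a b e → e * x ≡ 0 → x * isZero (c + a + b) ≤ x * isZero (c + e)
        elsewhere x c       a b zero    _    = ℕₚ.*-monoʳ-≤ x (isZero≤ c)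
          where
          isZero≤ : ∀ c → isZero (c + a + b) ≤ isZero (c + 0)
          isZero≤ zero    = isZero≤1 (a + b)
          isZero≤ (suc c) = z≤n
        elsewhere zero c a b (suc e) _ = z≤n
        product≥1 : ∀ {a b} → 1 ≤ a → 1 ≤ b → 1 ≤ a * b
        product≥1 = ℕₚ.*-mono-≤
        uncovered≤ : ∀ u → uncovered U M′ u ≤ z u
        uncovered≤ u with v₁ ≟ u | v₂ ≟ u
        ... | yes refl | _        = ≤-trans (≤-reflexive (cover₁ L₁.w~v)) z≤n
        ... | no _     | yes refl = ≤-trans (≤-reflexive (cover₂ L₂.w~v)) z≤n
        ... | no v₁≢u  | no v₂≢u  = subst₂ (λ c c′ → U u * isZero c ≤ U u * isZero c′) (sym (cover′ u)) (sym (cover-drop 1≤ u))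
          (elsewhere (U u) (cover M₀ u) (A w₁ u) (A w₂ u) (A t u) nothing)
          where
          -- The two nodes `v₁` and `v₂` already exhaust the load of `t`.
          nothing : A t u * U u ≡ 0
          nothing = ℕₚ.n≤0⇒n≡0 (ℕₚ.+-cancelˡ-≤ 2 _ _ (begin
            2 + A t u * U u                              ≤⟨ ℕₚ.+-monoˡ-≤ (A t u * U u) (ℕₚ.+-mono-≤ (product≥1 L₁.t~v L₁.v∈U) (product≥1 L₂.t~v L₂.v∈U)) ⟩
            A t v₁ * U v₁ + A t v₂ * U v₂ + A t u * U u  ≤⟨ three-terms≤sum (λ u → A t u * U u) v₁≢v₂ v₁≢u v₂≢u ⟩
            load U t                                     ≤⟨ load≤2 t ⟩
            2                                            ∎))
        pointwise : ∀ u → uncovered U M′ u + (point x₁ u + point x₂ u) ≤ z u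
        pointwise u with x₁ ≟ u | x₂ ≟ u
        ... | yes refl | yes refl = contradiction refl x₁≢x₂
        ... | yes refl | no _     = ≤-trans (≤-reflexive (cong (_+ 1) (cover₁ L₁.w~x))) L₁.x∈z
        ... | no _     | yes refl = ≤-trans (≤-reflexive (cong (_+ 1) (cover₂ L₂.w~x))) L₂.x∈z
        ... | no _     | no _     = ≤-trans (≤-reflexive (ℕₚ.+-identityʳ _)) (uncovered≤ u)
        z′ : ℕ
        z′ = sum (uncovered U M′)
        residual : z′ + 2 ≤ sum z
        residual = begin
          z′ + 2                                                  ≡⟨ cong (z′ +_) (cong₂ _+_ (sum-point x₁) (sum-point x₂)) ⟨
          z′ + (sum (point x₁) + sum (point x₂))                  ≡⟨ cong (z′ +_) (∑-distrib-+ (point x₁) (point x₂)) ⟨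
          z′ + sum (point x₁ ⊕ point x₂)                          ≡⟨ ∑-distrib-+ (uncovered U M′) (point x₁ ⊕ point x₂) ⟨
          sum (λ u → uncovered U M′ u + (point x₁ u + point x₂ u)) ≤⟨ sum-mono pointwise ⟩
          sum z                                                   ∎
        size : sum M′ ≡ sum M₀ + 2
        size = trans (sum-⊕-point (M₀ ⊕ point w₁) w₂) (trans (cong (_+ 1) (sum-⊕-point M₀ w₁)) (ℕₚ.+-assoc (sum M₀) 1 1))
        shuffle : ∀ m x → suc (3 * (m + 2) + 2 * x) ≡ 3 * (m + 1) + 2 * (x + 2)
        shuffle = solve-∀
        -- One more vertex costs 3, two fewer residual nodes save 4.
        cheaper : cost M′ < cost M
        cheaper = begin-strict
          3 * sum M′ + 2 * z′              ≡⟨ cong (λ s → 3 * s + 2 * z′) size ⟩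
          3 * (sum M₀ + 2) + 2 * z′        <⟨ ≤-reflexive (shuffle (sum M₀) z′) ⟩
          3 * (sum M₀ + 1) + 2 * (z′ + 2)  ≤⟨ ℕₚ.+-monoʳ-≤ (3 * (sum M₀ + 1)) (ℕₚ.*-monoʳ-≤ 2 residual) ⟩
          3 * (sum M₀ + 1) + 2 * sum z     ≡⟨ cong (λ s → 3 * s + 2 * sum z) (sum-drop 1≤) ⟨
          cost M                           ∎

      common : Fin n → Fin n → ℕ
      common t w = load (λ u → A w u * U u) t

      -- The product counts the pairs of a residual node `x` and a shared node `v` that make `w` a
      -- link at `t`.
      links : Fin n → Weight
      links t w = load z w * common t w

      module _ {t} (1≤ : 1 ≤ M t) where

        -- Shared nodes are covered by `t`, hence distinct from the residual ones. So the two
        -- factors add up to at most the load of `w`, which is at most 2, and the first is at most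
        -- 1.
        links≤1 : ∀ w → links t w ≤ 1
        links≤1 w = small (residual-load≤1 w) (≤-trans sum≤ (load≤2 w))
          where
          small : ∀ {y k} → y ≤ 1 → y + k ≤ 2 → y * k ≤ 1
          small {zero}  _ _ = z≤n
          small {suc zero} {k} _ (s≤s k≤1) = ≤-trans (≤-reflexive (ℕₚ.+-identityʳ k)) k≤1
          small {suc (suc _)} (s≤s ()) _
          disjoint : ∀ a b x c → b ≤ 1 → b ≤ c → a * (x * isZero c) + b * (a * x) ≤ a * x
          disjoint a zero x c _ _ = ≤-trans (≤-reflexive (ℕₚ.+-identityʳ _)) (ℕₚ.*-monoʳ-≤ a (≤-trans (ℕₚ.*-monoʳ-≤ x (isZero≤1 c)) (≤-reflexive (ℕₚ.*-identityʳ x))))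
          disjoint a (suc zero) x (suc c) _ _ = ≤-reflexive (cong₂ _+_ (trans (cong (a *_) (ℕₚ.*-zeroʳ x)) (ℕₚ.*-zeroʳ a)) (ℕₚ.+-identityʳ (a * x)))
          disjoint a (suc (suc _)) x c (s≤s ()) _
          sum≤ : load z w + common t w ≤ load U w
          sum≤ = ≤-trans (≤-reflexive (sym (∑-distrib-+ (λ u → A w u * z u) (λ u → A t u * (A w u * U u)))))
            (sum-mono λ u → disjoint (A w u) (A t u) (U u) (cover M u) (A≤1 t u) (member≤cover M t u 1≤))

        link : ∀ w → 1 ≤ links t w → ∃[ v ] ∃[ x ] Link t w v x
        link w p =
          let (x , px) = sum-positive (λ u → A w u * z u) (factorˡ p)
              (v , pv) = sum-positive (λ u → A t u * (A w u * U u)) (factorʳ {load z w} p)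
          in v , x , record
            { t~v = factorˡ pv ; w~v = factorˡ (factorʳ {A t v} pv) ; v∈U = factorʳ {A w v} (factorʳ {A t v} pv)
            ; w~x = factorˡ px ; x∈z = factorʳ {A w x} px }
          where
          factorˡ : ∀ {a b} → 1 ≤ a * b → 1 ≤ a
          factorˡ {suc a} _ = s≤s z≤n
          factorʳ : ∀ {a b} → 1 ≤ a * b → 1 ≤ b
          factorʳ {a} {zero}  p = ≤-trans p (≤-reflexive (ℕₚ.*-zeroʳ a))
          factorʳ {a} {suc b} _ = s≤s z≤n

        -- Pairs (v , x) any two of which agree in a coordinate all agree in one
        -- and the same coordinate, so the links at t all pass through one vertex.
        sum-links≤ : sum (links t) ≤ d
        sum-links≤ with any? (λ w → 1 ≤? links t w)
        ... | no none = ≤-trans (sum-mono λ w → ℕₚ.≤-pred (ℕₚ.≰⇒> λ p → none (w , p)))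
                          (≤-trans (≤-reflexive (trans (sum-const n 0) (ℕₚ.*-zeroʳ n))) z≤n)
        ... | yes (w₁ , p₁) with link w₁ p₁
        ...   | v₁ , x₁ , l₁ with all? (λ w → links t w ≤? A w x₁)
        ...     | yes through = ≤-trans (sum-mono through) (≤-reflexive (column x₁))
        ...     | no ¬through with ¬∀⟶∃¬ n _ (λ w → links t w ≤? A w x₁) ¬through
        ...       | w₂ , ≰₂ with link w₂ (≤-trans (s≤s z≤n) (ℕₚ.≰⇒> ≰₂))
        ...         | v₂ , x₂ , l₂ = ≤-trans (sum-mono through) (≤-reflexive (column v₁))
          where
          x₁≢x₂ : x₁ ≢ x₂
          x₁≢x₂ refl = ≰₂ (≤-trans (links≤1 w₂) (Link.w~x l₂))
          v₁≡v₂ : v₁ ≡ v₂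
          v₁≡v₂ with v₁ ≟ v₂
          ... | yes eq = eq
          ... | no neq = contradiction (links-meet 1≤ l₁ l₂ neq) x₁≢x₂
          through : ∀ w → links t w ≤ A w v₁
          through w with 1 ≤? links t w
          ... | no ≰ = ≤-trans (ℕₚ.≤-pred (ℕₚ.≰⇒> ≰)) z≤n
          ... | yes p with link w p
          ...   | v , x , l with v₁ ≟ v
          ...     | yes refl = ≤-trans (links≤1 w) (Link.w~v l)
          -- A link avoiding `v₁` would share its residual node with both links found so far, but
          -- their residual nodes differ.
          ...     | no neq = contradiction
                      (trans (links-meet 1≤ l₁ l neq) (sym (links-meet 1≤ l₂ l (neq ∘ trans v₁≡v₂)))) x₁≢x₂

      -- A vertex with one residual and one covered node is a link at a member of `M` that covers
      -- the latter, so summing the links over `M` counts all mixed vertices.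
      sum-mixed≤ : ∑[ w < n ] (load z w * load covered w) ≤ d * sum M
      sum-mixed≤ = begin
        ∑[ w < n ] (load z w * load covered w)
          ≤⟨ sum-mono (λ w → ℕₚ.*-monoʳ-≤ (load z w) (load-mono covered≤ w)) ⟩
        ∑[ w < n ] (load z w * load (λ u → U u * cover M u) w)
          ≡⟨ sum-cong-≗ (λ w → cong (load z w *_) (sum-cong-≗ λ u → sym (ℕₚ.*-assoc (A w u) (U u) (cover M u)))) ⟩
        ∑[ w < n ] (load z w * ∑[ u < n ] (A w u * U u * cover M u))
          ≡⟨ sum-cong-≗ (λ w → cong (load z w *_) (sum-*-cover (λ u → A w u * U u) M)) ⟩
        ∑[ w < n ] (load z w * ∑[ t < n ] (M t * common t w))
          ≡⟨ sum-cong-≗ (λ w → *-distribˡ-sum (load z w) (λ t → M t * common t w)) ⟩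
        ∑[ w < n ] ∑[ t < n ] (load z w * (M t * common t w))
          ≡⟨ ∑-comm (λ w t → load z w * (M t * common t w)) ⟩
        ∑[ t < n ] ∑[ w < n ] (load z w * (M t * common t w))
          ≡⟨ sum-cong-≗ (λ t → sum-cong-≗ λ w → rearrange (load z w) (M t) (common t w)) ⟩
        ∑[ t < n ] ∑[ w < n ] (M t * links t w)
          ≡⟨ sum-cong-≗ (λ t → sum-*ˡ (M t) (links t)) ⟩
        ∑[ t < n ] (M t * sum (links t))
          ≤⟨ sum-mono bounded ⟩
        ∑[ t < n ] (d * M t)
          ≡⟨ sum-*ˡ d M ⟩
        d * sum M ∎
        where
        open ≤-Reasoning
        rearrange : ∀ a b c → a * (b * c) ≡ b * (a * c)
        rearrange = solve-∀
        bounded : ∀ t → M t * sum (links t) ≤ d * M t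
        bounded t with 1 ≤? M t
        ... | yes 1≤ = ≤-trans (ℕₚ.*-monoʳ-≤ (M t) (sum-links≤ 1≤)) (≤-reflexive (ℕₚ.*-comm (M t) d))
        ... | no ≰ rewrite ℕₚ.n≤0⇒n≡0 (ℕₚ.≤-pred (ℕₚ.≰⇒> ≰)) = z≤n

      -- Write m and x for the sizes of the matching and of the residue. Then 3d(2m + x) is at most
      -- three times the total load. Vertex by vertex, three times the load is at most the weight
      -- plus the covered load plus the mixed product; the last two sum to at most 2dm and dm.
      -- Cancelling 3dm leaves the bound.
      matching-bound : 3 * d * (sum M + sum z) ≤ ∑[ v < n ] matchingWeight (load U v)
      matching-bound = ℕₚ.+-cancelʳ-≤ (d * (2 * sum M) + d * sum M) _ _ (begin
        3 * d * (sum M + sum z) + (d * (2 * sum M) + d * sum M)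
          ≡⟨ shuffle d (sum M) (sum z) ⟩
        3 * (d * (2 * sum M + sum z))
          ≤⟨ ℕₚ.*-monoʳ-≤ 3 (ℕₚ.*-monoʳ-≤ d 2*size+residual≤) ⟩
        3 * (d * sum U)
          ≡⟨ cong (3 *_) (sum-load U) ⟨
        3 * sum (load U)
          ≡⟨ sum-*ˡ 3 (load U) ⟨
        ∑[ v < n ] (3 * load U v)
          ≤⟨ sum-mono pointwise ⟩
        ∑[ v < n ] (G v + (load covered v + load z v * load covered v))
          ≡⟨ ∑-distrib-+ G (λ v → load covered v + load z v * load covered v) ⟩
        sum G + ∑[ v < n ] (load covered v + load z v * load covered v)
          ≡⟨ cong (sum G +_) (∑-distrib-+ (load covered) (λ v → load z v * load covered v)) ⟩
        sum G + (sum (load covered) + ∑[ v < n ] (load z v * load covered v))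
          ≡⟨ cong (λ s → sum G + (s + ∑[ v < n ] (load z v * load covered v))) (sum-load covered) ⟩
        sum G + (d * sum covered + ∑[ v < n ] (load z v * load covered v))
          ≤⟨ ℕₚ.+-monoʳ-≤ (sum G) (ℕₚ.+-mono-≤ (ℕₚ.*-monoʳ-≤ d sum-covered≤) sum-mixed≤) ⟩
        sum G + (d * (2 * sum M) + d * sum M) ∎)
        where
        open ≤-Reasoning
        G : Weight
        G v = matchingWeight (load U v)
        shuffle : ∀ d m x → 3 * d * (m + x) + (d * (2 * m) + d * m) ≡ 3 * (d * (2 * m + x))
        shuffle = solve-∀
        -- Here `y` and `s` are the residual and the covered load. Only a vertex of load 1 whose
        -- node is covered leaves slack.
        cases : ∀ y s → y ≤ 1 → y + s ≤ 2 → 3 * (y + s) ≤ matchingWeight (y + s) + (s + y * s)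
        cases 0 0 _ _ = z≤n
        cases 0 1 _ _ = ℕₚ.m≤m+n 3 1
        cases 0 2 _ _ = ≤-refl
        cases 1 0 _ _ = ≤-refl
        cases 1 1 _ _ = ≤-refl
        cases 0 (suc (suc (suc _))) _ (s≤s (s≤s ()))
        cases 1 (suc (suc _)) _ (s≤s (s≤s ()))
        cases (suc (suc _)) _ (s≤s ()) _
        pointwise : ∀ v → 3 * load U v ≤ G v + (load covered v + load z v * load covered v)
        pointwise v = subst (λ r → 3 * r ≤ matchingWeight r + (load covered v + load z v * load covered v)) (load-split v)
          (cases (load z v) (load covered v) (residual-load≤1 v) (subst (_≤ 2) (sym (load-split v)) (load≤2 v)))

  -- Increments of the concave function g, scaled by 3dc: the matching costs
  -- 1/d and 4/(3d) per vertex of load 1 and 2, which fixes the first two.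
  record Increments : Set where
    field
      c      : ℕ
      δ      : ℕ → ℕ
      δ-step : ∀ i → δ (suc i) ≤ δ i
      δ₀     : δ 0 ≡ 3 * c
      δ₁     : δ 1 ≡ c
      j      : ℕ
      degree≡ : d ≡ 2 + j
      gain   : ∀ i → i < j → 3 * d * c + δ (2 + i) * (3 + i) < δ (2 + i) * (d * (3 + i)) + prefixSum δ (3 + i)

  -- The two stages combined

  module _ (I : Increments) where
    open Increments I

    private
      N : ℕ
      N = 3 * d * c

      𝟏 : Weight
      𝟏 _ = 1

      open Greedy N δ δ-step 𝟏

    load-𝟏 : ∀ v → load 𝟏 v ≡ d
    load-𝟏 v = trans (sum-cong-≗ λ u → ℕₚ.*-identityʳ (A v u)) (row v)

    -- The empty set is the competitor of the minimiser: all loads are then `d`, and its potential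
    -- is the final bound.
    potential-∅ : potential (λ _ → 0) ≡ n * prefixSum δ d
    potential-∅ = begin
      N * ∑[ v < n ] 0 + ∑[ v < n ] g (load (uncovered 𝟏 (λ _ → 0)) v)
        ≡⟨ cong₂ _+_ (trans (cong (N *_) none) (ℕₚ.*-zeroʳ N)) (sum-cong-≗ λ v → cong g (trans (load-cong (λ u → cong (λ c → 1 * isZero c) none) v) (load-𝟏 v))) ⟩
      ∑[ v < n ] g d
        ≡⟨ sum-const n (g d) ⟩
      n * g d ∎
      where
      open ≡-Reasoning
      none : ∑[ v < n ] 0 ≡ 0
      none = trans (sum-const n 0) (ℕₚ.*-zeroʳ n)

    -- The values of `g` at the loads left by the first stage pay exactly for the completion.
    g≡ : ∀ r → r ≤ 2 → g r ≡ c * matchingWeight r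
    g≡ 0 _ = sym (ℕₚ.*-zeroʳ c)
    g≡ 1 _ = trans δ₀ (ℕₚ.*-comm 3 c)
    g≡ 2 _ = trans (cong₂ _+_ δ₀ δ₁) (four c)
      where
      four : ∀ c → 3 * c + c ≡ c * 4
      four = solve-∀
    g≡ (suc (suc (suc _))) (s≤s (s≤s ()))

    neighbour : ∀ u → ∃[ v ] 1 ≤ A v u
    neighbour u = sum-positive (λ v → A v u) (subst (1 ≤_) (sym (trans (column u) degree≡)) (s≤s z≤n))

    -- One chosen neighbour for every element of `Z`, with multiplicity, so that the total weight is
    -- preserved.
    complete : Weight → Weight
    complete Z v = ∑[ u < n ] (point (proj₁ (neighbour u)) v * Z u)

    sum-complete : ∀ Z → sum (complete Z) ≡ sum Z
    sum-complete Z = begin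
      ∑[ v < n ] ∑[ u < n ] (point (proj₁ (neighbour u)) v * Z u)  ≡⟨ ∑-comm (λ v u → point (proj₁ (neighbour u)) v * Z u) ⟩
      ∑[ u < n ] ∑[ v < n ] (point (proj₁ (neighbour u)) v * Z u)  ≡⟨ sum-cong-≗ (λ u → sum-point-* (proj₁ (neighbour u)) (λ _ → Z u)) ⟩
      sum Z                                                        ∎
      where open ≡-Reasoning

    cover-complete : ∀ Z u → 1 ≤ Z u → 1 ≤ cover (complete Z) u
    cover-complete Z u 1≤Z = let (v , 1≤A) = neighbour u in ≤-trans 1≤A (member≤cover (complete Z) v u (begin
      1                          ≤⟨ 1≤Z ⟩
      Z u                        ≡⟨ ℕₚ.*-identityˡ (Z u) ⟨
      1 * Z u                    ≡⟨ cong (_* Z u) (point-self v) ⟨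
      point v v * Z u            ≤⟨ term≤sum (λ w → point (proj₁ (neighbour w)) v * Z w) u ⟩
      complete Z v               ∎))
      where open ≤-Reasoning

    -- The vertices added to the minimiser `S` cost at most the sum of `g` over its loads. So the
    -- whole weight costs at most `potential S`, which does not exceed the potential of the empty
    -- set.
    dominating-weight : ¬ ¬ (∃[ C ] (∀ u → 1 ≤ cover C u) × N * sum C ≤ n * prefixSum δ d)
    dominating-weight absurd = ¬¬-minimiser potential (λ _ → 0) λ (S , S-minimal) →
      let U     = uncovered 𝟏 S
          -- The descent starts from the trivial bound `d`, that is `2 + j`, on all loads.
          load≤ = minimiser-load≤ S S-minimal 2 j gain λ v →
                    subst (load U v ≤_) (trans (load-𝟏 v) degree≡) (load-mono (λ u → ℕₚ.*-monoʳ-≤ 1 (isZero≤1 (cover S u))) v)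
          open Matching U load≤
      in ¬¬-minimiser cost (λ _ → 0) λ (M , M-minimal) → absurd (combine S S-minimal load≤ M (matching-bound M M-minimal))
      where
      combine : ∀ S → (∀ T → potential S ≤ potential T) → (∀ v → load (uncovered 𝟏 S) v ≤ 2) → ∀ M →
        3 * d * (sum M + sum (uncovered (uncovered 𝟏 S) M)) ≤ ∑[ v < n ] matchingWeight (load (uncovered 𝟏 S) v) →
        ∃[ C ] (∀ u → 1 ≤ cover C u) × N * sum C ≤ n * prefixSum δ d
      combine S S-minimal load≤ M bound = S ⊕ M ⊕ complete Z , dominated , small
        where
        open ≤-Reasoning
        U Z : Weight
        U = uncovered 𝟏 S
        Z = uncovered U M
        dominated : ∀ u → 1 ≤ cover (S ⊕ M ⊕ complete Z) u
        dominated u = subst (1 ≤_) (sym (trans (cover-⊕ (S ⊕ M) (complete Z) u) (cong (_+ cover (complete Z) u) (cover-⊕ S M u))))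
          (cases (cover S u) (cover M u) (cover-complete Z u))
          where
          cases : ∀ a b {e} → (1 ≤ 1 * isZero a * isZero b → 1 ≤ e) → 1 ≤ a + b + e
          cases zero    zero    p = p ≤-refl
          cases zero    (suc b) p = s≤s z≤n
          cases (suc a) b       p = s≤s z≤n
        size : sum (S ⊕ M ⊕ complete Z) ≡ sum S + sum M + sum Z
        size = trans (∑-distrib-+ (S ⊕ M) (complete Z)) (cong₂ _+_ (∑-distrib-+ S M) (sum-complete Z))
        shuffle : ∀ d c s m z → 3 * d * c * (s + m + z) ≡ 3 * d * c * s + c * (3 * d * (m + z))
        shuffle = solve-∀
        small : N * sum (S ⊕ M ⊕ complete Z) ≤ n * prefixSum δ d
        small = begin
          N * sum (S ⊕ M ⊕ complete Z)                              ≡⟨ cong (N *_) size ⟩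
          N * (sum S + sum M + sum Z)                               ≡⟨ shuffle d c (sum S) (sum M) (sum Z) ⟩
          N * sum S + c * (3 * d * (sum M + sum Z))                 ≤⟨ ℕₚ.+-monoʳ-≤ (N * sum S) (ℕₚ.*-monoʳ-≤ c bound) ⟩
          N * sum S + c * ∑[ v < n ] matchingWeight (load U v)      ≡⟨ cong (N * sum S +_) (sum-*ˡ c (λ v → matchingWeight (load U v))) ⟨
          N * sum S + ∑[ v < n ] (c * matchingWeight (load U v))    ≡⟨ cong (N * sum S +_) (sum-cong-≗ λ v → g≡ (load U v) (load≤ v)) ⟨
          potential S                                               ≤⟨ S-minimal (λ _ → 0) ⟩
          potential (λ _ → 0)                                       ≡⟨ potential-∅ ⟩
          n * prefixSum δ d                                         ∎

-- Total domination numbers of graphs and their covers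

module Graphs where
  open Nat using (_+_; _*_)

  indicator : ∀ {n} → Subset n → Fin n → ℕ
  indicator S v = if lookup S v then 1 else 0

  ∣∣≡sum : ∀ {n} (S : Subset n) → ∣ S ∣ ≡ sum (indicator S)
  ∣∣≡sum []          = refl
  ∣∣≡sum (true ∷ S)  = cong suc (∣∣≡sum S)
  ∣∣≡sum (false ∷ S) = ∣∣≡sum S

  ∣⟦⟧∣≡sum : ∀ {n} {P : Fin n → Set} (P? : ∀ v → Dec (P v)) → ∣ ⟦ P? ⟧ ∣ ≡ ∑[ v < n ] 𝟙 (P? v)
  ∣⟦⟧∣≡sum P? = trans (∣∣≡sum ⟦ P? ⟧) (sum-cong-≗ λ v → cong (λ b → if b then 1 else 0) (lookup∘tabulate (λ v → does (P? v)) v))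

  ∈⟦⟧ : ∀ {n} {P : Fin n → Set} (P? : ∀ v → Dec (P v)) v → P v → v ∈ ⟦ P? ⟧
  ∈⟦⟧ P? v p = lookup⇒[]= v ⟦ P? ⟧ (trans (lookup∘tabulate (λ v → does (P? v)) v) holds)
    where
    holds : does (P? v) ≡ true
    holds with P? v
    ... | yes _ = refl
    ... | no ¬p = contradiction p ¬p

  module _ (G : Graph) where
    open Graph G using (_~_; _~?_; ~-sym)

    adj : Vertex G → Vertex G → ℕ
    adj v u = 𝟙 (v ~? u)

    adj≤1 : ∀ v u → adj v u ≤ 1
    adj≤1 v u = 𝟙≤1 (v ~? u)

    adj-sym : ∀ v u → adj v u ≡ adj u v
    adj-sym v u with u ~? v
    ... | yes u~v = 𝟙-true (v ~? u) (~-sym u~v)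
    ... | no ¬u~v = 𝟙-false (v ~? u) (¬u~v ∘ ~-sym)

    degree≡sum : ∀ v → degree G v ≡ sum (adj v)
    degree≡sum v = ∣⟦⟧∣≡sum (v ~?_)

    neighbour-of-positive-degree : ∀ v → 1 ≤ degree G v → ∃[ u ] v ~ u
    neighbour-of-positive-degree v 1≤ = let (u , p) = sum-positive (adj v) (subst (1 ≤_) (degree≡sum v) 1≤) in u , 𝟙-holds (v ~? u) p

    -- The support of `C` is total dominating, and each of its vertices contributes at least 1 to
    -- `sum C`.
    γt≤weight : ∀ C → (∀ u → 1 ≤ ∑[ v < order G ] (C v * adj v u)) → γt G ≤ sum C
    γt≤weight C dominated = begin
      γt G                              ≤⟨ γt-minimal G ⟦ (λ v → 1 ≤? C v) ⟧ dominating ⟩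
      ∣ ⟦ (λ v → 1 ≤? C v) ⟧ ∣            ≡⟨ ∣⟦⟧∣≡sum (λ v → 1 ≤? C v) ⟩
      sum (λ v → 𝟙 (1 ≤? C v))          ≤⟨ sum-mono (λ v → indicator≤ (C v)) ⟩
      sum C                             ∎
      where
      open ≤-Reasoning
      indicator≤ : ∀ c → 𝟙 (1 ≤? c) ≤ c
      indicator≤ zero    = z≤n
      indicator≤ (suc _) = s≤s z≤n
      dominating : IsTotalDominating G ⟦ (λ v → 1 ≤? C v) ⟧
      dominating u with sum-positive (λ v → C v * adj v u) (dominated u)
      ... | v , p with v ~? u | 1 ≤? C v
      ...   | yes v~u | yes q = v , ∈⟦⟧ (λ v → 1 ≤? C v) v q , ~-sym v~u
      ...   | yes v~u | no ¬q = contradiction (subst (1 ≤_) (ℕₚ.*-identityʳ (C v)) p) ¬q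
      ...   | no _    | _     = contradiction (subst (1 ≤_) (ℕₚ.*-zeroʳ (C v)) p) λ ()

    -- Double counting of pairs of a vertex and its dominator: every vertex has one, and a member of
    -- the set dominates at most `d` vertices. Absence of isolated vertices ensures that `γt` is
    -- attained.
    order≤degree*γt : ∀ d → (∀ v → 1 ≤ degree G v) → (∀ v → degree G v ≤ d) → order G ≤ d * γt G
    order≤degree*γt d noIsolated degree≤ with γt-attained G (λ v → neighbour-of-positive-degree v (noIsolated v))
    ... | S , dominating , size = begin
      order G                                                    ≡⟨ trans (sum-const (order G) 1) (ℕₚ.*-identityʳ (order G)) ⟨
      ∑[ v < order G ] 1                                         ≤⟨ sum-mono hit ⟩
      ∑[ v < order G ] ∑[ u < order G ] (indicator S u * adj u v) ≡⟨ ∑-comm (λ v u → indicator S u * adj u v) ⟩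
      ∑[ u < order G ] ∑[ v < order G ] (indicator S u * adj u v) ≡⟨ sum-cong-≗ (λ u → sum-*ˡ (indicator S u) (adj u)) ⟩
      ∑[ u < order G ] (indicator S u * sum (adj u))             ≤⟨ sum-mono (λ u → ℕₚ.*-monoʳ-≤ (indicator S u) (subst (_≤ d) (degree≡sum u) (degree≤ u))) ⟩
      ∑[ u < order G ] (indicator S u * d)                       ≡⟨ sum-cong-≗ (λ u → ℕₚ.*-comm (indicator S u) d) ⟩
      ∑[ u < order G ] (d * indicator S u)                       ≡⟨ sum-*ˡ d (indicator S) ⟩
      d * sum (indicator S)                                      ≡⟨ cong (d *_) (trans (sym (∣∣≡sum S)) size) ⟩
      d * γt G                                                   ∎
      where
      open ≤-Reasoning
      hit : ∀ v → 1 ≤ ∑[ u < order G ] (indicator S u * adj u v)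
      hit v with dominating v
      ... | u , u∈S , v~u = begin
        1                          ≡⟨ cong₂ (λ b a → (if b then 1 else 0) * a) ([]=⇒lookup u∈S) (𝟙-true (u ~? v) (~-sym v~u)) ⟨
        indicator S u * adj u v    ≤⟨ term≤sum (λ u → indicator S u * adj u v) u ⟩
        ∑[ u < order G ] (indicator S u * adj u v) ∎

  -- Order and degrees of a cover

  module Cover (F G : Graph) (k : ℕ) (cover : KFoldCover k G F) where
    open KFoldCover cover
    open IsCover isCover
    private
      module F = Graph F
      module G = Graph G

    order-cover : order G ≡ k * order F
    order-cover = begin
      order G                                                    ≡⟨ trans (sum-const (order G) 1) (ℕₚ.*-identityʳ (order G)) ⟨
      ∑[ v < order G ] 1                                         ≡⟨ sum-cong-≗ (λ v → sum-point (π v)) ⟨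
      ∑[ v < order G ] ∑[ u < order F ] point (π v) u            ≡⟨ ∑-comm (λ v u → point (π v) u) ⟩
      ∑[ u < order F ] ∑[ v < order G ] point (π v) u            ≡⟨ sum-cong-≗ (λ u → trans (sym (∣⟦⟧∣≡sum (λ v → π v ≟ u))) (kFold u)) ⟩
      ∑[ u < order F ] k                                         ≡⟨ sum-const (order F) k ⟩
      order F * k                                                ≡⟨ ℕₚ.*-comm (order F) k ⟩
      k * order F                                                ∎
      where open ≡-Reasoning

    -- Sort the neighbours of `v` by fibre: a fibre contains at most one by local injectivity, and
    -- none unless it lies over a neighbour of `π v`.
    degree-cover≤ : ∀ v → degree G v ≤ degree F (π v)
    degree-cover≤ v = begin
      degree G v                                                         ≡⟨ degree≡sum G v ⟩
      sum (adj G v)                                                      ≡⟨ sum-cong-≗ (λ w → sum-point-* (π w) (λ _ → adj G v w)) ⟨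
      ∑[ w < order G ] ∑[ u < order F ] (point (π w) u * adj G v w)      ≡⟨ ∑-comm (λ w u → point (π w) u * adj G v w) ⟩
      ∑[ u < order F ] ∑[ w < order G ] (point (π w) u * adj G v w)      ≤⟨ sum-mono (λ u → sum-unique-support (λ w → point (π w) u * adj G v w) (adj F (π v) u) (lifts≤ u) (unique u)) ⟩
      sum (adj F (π v))                                                  ≡⟨ degree≡sum F (π v) ⟨
      degree F (π v)                                                     ∎
      where
      open ≤-Reasoning
      open MapsBijectively (neighbours v)
      lifts≤ : ∀ u w → point (π w) u * adj G v w ≤ adj F (π v) u
      lifts≤ u w with π w ≟ u | v G.~? w
      ... | no _     | _       = z≤n
      ... | yes _    | no _    = z≤n
      ... | yes refl | yes v~w = ≤-reflexive (sym (𝟙-true (π v F.~? π w) (mapsTo v~w)))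
      support : ∀ u w → 1 ≤ point (π w) u * adj G v w → π w ≡ u × v G.~ w
      support u w p with π w ≟ u | v G.~? w
      ... | yes πw≡u | yes v~w = πw≡u , v~w
      unique : ∀ u w w′ → 1 ≤ point (π w) u * adj G v w → 1 ≤ point (π w′) u * adj G v w′ → w ≡ w′
      unique u w w′ p p′ =
        let (πw≡u , v~w) = support u w p ; (πw′≡u , v~w′) = support u w′ p′
        in injectiveOn v~w v~w′ (trans πw≡u (sym πw′≡u))

    -- An edge at `π v` lifts to an edge at `v`; this rules out isolated vertices, where `γt` would
    -- be a junk value.
    degree-cover≥1 : (∀ u → 1 ≤ degree F u) → ∀ v → 1 ≤ degree G v
    degree-cover≥1 positive v =
      let (u , πv~u)  = neighbour-of-positive-degree F (π v) (positive (π v))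
          (w , v~w , _) = MapsBijectively.onto (neighbours v) πv~u
      in subst (1 ≤_) (sym (degree≡sum G v)) (≤-trans (≤-reflexive (sym (𝟙-true (v G.~? w) v~w))) (term≤sum (adj G v) w))

    order*k≤degree*γt : ∀ d → 1 ≤ d → Regular d F → k * order F ≤ d * γt G
    order*k≤degree*γt d 1≤d regular = subst (_≤ d * γt G) order-cover (order≤degree*γt G d
      (degree-cover≥1 (λ u → subst (1 ≤_) (sym (regular u)) 1≤d))
      (λ v → subst (degree G v ≤_) (regular (π v)) (degree-cover≤ v)))

  -- Upper bounds in degrees 3, 4 and 5

  module RegularGraph (F : Graph) {d} (regular : Regular d F) where

    row : ∀ v → sum (adj F v) ≡ d
    row v = trans (sym (degree≡sum F v)) (regular v)

    column : ∀ u → sum (λ v → adj F v u) ≡ d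
    column u = trans (sum-cong-≗ λ v → adj-sym F v u) (row u)

    open Domination (adj F) (adj≤1 F) row column public

    -- The bound is decidable, so the double negation coming from the minimisers can be removed.
    γt-bound : (I : Increments) → 3 * d * Increments.c I * γt F ≤ order F * prefixSum (Increments.δ I) d
    γt-bound I = decidable-stable (_ ≤? _) λ ¬bound → dominating-weight I λ (C , dominated , small) →
      ¬bound (≤-trans (ℕₚ.*-monoʳ-≤ (3 * d * Increments.c I) (γt≤weight F C dominated)) small)

  -- At scale 9 the increments 3, 1, 1 sum to 5. The bound 5n/9 fits the factor 3/5, whose product
  -- with it is the n/3 available per sheet of the cover.
  γt-cubic : ∀ F → Regular 3 F → 9 * γt F ≤ order F * 5
  γt-cubic F regular = γt-bound record
    { c = 1 ; δ = δ ; δ-step = δ-step ; δ₀ = refl ; δ₁ = refl ; j = 1 ; degree≡ = refl ; gain = gain }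
    where
    open RegularGraph F regular
    δ : ℕ → ℕ
    δ 0 = 3
    δ _ = 1
    δ-step : ∀ i → δ (suc i) ≤ δ i
    δ-step 0       = s≤s z≤n
    δ-step (suc _) = ≤-refl
    gain : ∀ i → i < 1 → 9 + δ (2 + i) * (3 + i) < δ (2 + i) * (3 * (3 + i)) + prefixSum δ (3 + i)
    gain 0 _ = from-yes (12 Nat.<? 14)
    gain (suc _) (s≤s ())

  -- At scale 12 the increments 3, 1, 1, 1 sum to 6. Half of the resulting n/2 is the n/4 available
  -- per sheet of the cover.
  γt-quartic : ∀ F → Regular 4 F → 12 * γt F ≤ order F * 6
  γt-quartic F regular = γt-bound record
    { c = 1 ; δ = δ ; δ-step = δ-step ; δ₀ = refl ; δ₁ = refl ; j = 2 ; degree≡ = refl ; gain = gain }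
    where
    open RegularGraph F regular
    δ : ℕ → ℕ
    δ 0 = 3
    δ _ = 1
    δ-step : ∀ i → δ (suc i) ≤ δ i
    δ-step 0       = s≤s z≤n
    δ-step (suc _) = ≤-refl
    gain : ∀ i → i < 2 → 12 + δ (2 + i) * (3 + i) < δ (2 + i) * (4 * (3 + i)) + prefixSum δ (3 + i)
    gain 0 _ = from-yes (15 Nat.<? 17)
    gain 1 _ = from-yes (16 Nat.<? 22)
    gain (suc (suc _)) (s≤s (s≤s ()))

  γt-quintic : ∀ F → Regular 5 F → 120 * γt F ≤ order F * 48
  γt-quintic F regular = γt-bound record
    { c = 8 ; δ = δ ; δ-step = δ-step ; δ₀ = refl ; δ₁ = refl ; j = 3 ; degree≡ = refl ; gain = gain }
    where
    open RegularGraph F regular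
    -- The value 48/120 = 2/5 at 5 leaves little room in gain: at scale 15 the value
    -- at 3 must lie between 4.85 and 4.96, and 39/8 is the reason for c = 8.
    δ : ℕ → ℕ
    δ 0 = 24
    δ 1 = 8
    δ 2 = 7
    δ 3 = 5
    δ _ = 4
    δ-step : ∀ i → δ (suc i) ≤ δ i
    δ-step 0 = from-yes (8 ≤? 24)
    δ-step 1 = from-yes (7 ≤? 8)
    δ-step 2 = from-yes (5 ≤? 7)
    δ-step 3 = from-yes (4 ≤? 5)
    δ-step (suc (suc (suc (suc _)))) = ≤-refl
    gain : ∀ i → i < 3 → 120 + δ (2 + i) * (3 + i) < δ (2 + i) * (5 * (3 + i)) + prefixSum δ (3 + i)
    gain 0 _ = from-yes (141 Nat.<? 144)
    gain 1 _ = from-yes (140 Nat.<? 144)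
    gain 2 _ = from-yes (140 Nat.<? 148)
    gain (suc (suc (suc _))) (s≤s (s≤s (s≤s ())))

  -- Comparison of both bounds through the order of the base graph

  cover-bound : ∀ {F G k} d → KFoldCover k G F → Regular (suc d) F → ∀ a b →
    a * γt F ≤ order F * b → k * (a * γt F) ≤ b * (suc d * γt G)
  cover-bound {F} {G} {k} d cover regular a b upper = begin
    k * (a * γt F)      ≤⟨ ℕₚ.*-monoʳ-≤ k upper ⟩
    k * (order F * b)   ≡⟨ rearrange k (order F) b ⟩
    b * (k * order F)   ≤⟨ ℕₚ.*-monoʳ-≤ b (Cover.order*k≤degree*γt F G k cover (suc d) (s≤s z≤n) regular) ⟩
    b * (suc d * γt G)  ∎
    where
    open ≤-Reasoning
    rearrange : ∀ k n b → k * (n * b) ≡ b * (k * n)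
    rearrange = solve-∀

  -- Unnormalised rationals multiply componentwise, so after the transfer the claim is a
  -- cross-multiplied inequality between integers. The argument `q` is one less than the
  -- denominator.
  clear-denominators : ∀ p q k f g → p * k * f ≤ suc q * g →
    ((Int.+ p) Rat./ suc q) Rat.* fromℕ k Rat.* fromℕ f Rat.≤ fromℕ g
  clear-denominators p q k f g h = ℚₚ.toℚᵘ-cancel-≤ (begin
    Rat.toℚᵘ (((Int.+ p) Rat./ suc q) Rat.* fromℕ k Rat.* fromℕ f)
      ≃⟨ ℚₚ.toℚᵘ-homo-* (((Int.+ p) Rat./ suc q) Rat.* fromℕ k) (fromℕ f) ⟩
    Rat.toℚᵘ (((Int.+ p) Rat./ suc q) Rat.* fromℕ k) ℚᵘ.* Rat.toℚᵘ (fromℕ f)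
      ≃⟨ ℚᵘₚ.*-cong (ℚₚ.toℚᵘ-homo-* ((Int.+ p) Rat./ suc q) (fromℕ k)) ℚᵘₚ.≃-refl ⟩
    Rat.toℚᵘ ((Int.+ p) Rat./ suc q) ℚᵘ.* Rat.toℚᵘ (fromℕ k) ℚᵘ.* Rat.toℚᵘ (fromℕ f)
      ≃⟨ ℚᵘₚ.*-cong (ℚᵘₚ.*-cong (ℚₚ.toℚᵘ-fromℚᵘ (ℚᵘ.mkℚᵘ (Int.+ p) q)) (ℚₚ.toℚᵘ-fromℚᵘ (ℚᵘ.mkℚᵘ (Int.+ k) 0))) (ℚₚ.toℚᵘ-fromℚᵘ (ℚᵘ.mkℚᵘ (Int.+ f) 0)) ⟩
    ℚᵘ.mkℚᵘ (Int.+ p) q ℚᵘ.* ℚᵘ.mkℚᵘ (Int.+ k) 0 ℚᵘ.* ℚᵘ.mkℚᵘ (Int.+ f) 0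
      ≤⟨ ℚᵘ.*≤* inℤ ⟩
    ℚᵘ.mkℚᵘ (Int.+ g) 0
      ≃⟨ ℚₚ.toℚᵘ-fromℚᵘ (ℚᵘ.mkℚᵘ (Int.+ g) 0) ⟨
    Rat.toℚᵘ (fromℕ g) ∎)
    where
    open ℚᵘₚ.≤-Reasoning
    inℤ : (Int.+ p) Int.* (Int.+ k) Int.* (Int.+ f) Int.* (Int.+ 1) Int.≤ (Int.+ g) Int.* (Int.+ (suc q * 1 * 1))
    inℤ = subst₂ Int._≤_ left right (Int.+≤+ h)
      where
      left : Int.+ (p * k * f) ≡ (Int.+ p) Int.* (Int.+ k) Int.* (Int.+ f) Int.* (Int.+ 1)
      left = trans (ℤₚ.pos-* (p * k) f) (trans (cong (Int._* (Int.+ f)) (ℤₚ.pos-* p k)) (sym (ℤₚ.*-identityʳ _)))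
      right : Int.+ (suc q * g) ≡ (Int.+ g) Int.* (Int.+ (suc q * 1 * 1))
      right = trans (cong Int.+_ (trans (ℕₚ.*-comm (suc q) g) (cong (g *_) (sym (trans (ℕₚ.*-identityʳ _) (ℕₚ.*-identityʳ _)))))) (ℤₚ.pos-* g _)

  theorem-ℕ : ∀ F G k → KFoldCover k G F →
    (Regular 3 F → 3 * k * γt F ≤ 5 * γt G) × (Regular 4 F ⊎ Regular 5 F → 1 * k * γt F ≤ 2 * γt G)
  theorem-ℕ F G k cover = cubic , λ { (inj₁ quartic) → four quartic ; (inj₂ quintic) → five quintic }
    where
    -- The factors 3, 12 and 120 below are common to both sides of the respective instances of
    -- `cover-bound`.
    scale : ∀ m .{{_ : Nat.NonZero m}} {a b c e} → a ≡ m * b → c ≡ m * e → a ≤ c → b ≤ e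
    scale m refl refl = ℕₚ.*-cancelˡ-≤ m
    cubic : Regular 3 F → 3 * k * γt F ≤ 5 * γt G
    cubic regular = scale 3 (left k (γt F)) (right (γt G)) (cover-bound 2 cover regular 9 5 (γt-cubic F regular))
      where
      left : ∀ k f → k * (9 * f) ≡ 3 * (3 * k * f)
      left = solve-∀
      right : ∀ g → 5 * (3 * g) ≡ 3 * (5 * g)
      right = solve-∀
    four : Regular 4 F → 1 * k * γt F ≤ 2 * γt G
    four regular = scale 12 (left k (γt F)) (right (γt G)) (cover-bound 3 cover regular 12 6 (γt-quartic F regular))
      where
      left : ∀ k f → k * (12 * f) ≡ 12 * (1 * k * f)
      left = solve-∀
      right : ∀ g → 6 * (4 * g) ≡ 12 * (2 * g)
      right = solve-∀
    five : Regular 5 F → 1 * k * γt F ≤ 2 * γt G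
    five regular = scale 120 (left k (γt F)) (right (γt G)) (cover-bound 4 cover regular 120 48 (γt-quintic F regular))
      where
      left : ∀ k f → k * (120 * f) ≡ 120 * (1 * k * f)
      left = solve-∀
      right : ∀ g → 48 * (5 * g) ≡ 120 * (2 * g)
      right = solve-∀

open Graphs using (theorem-ℕ; clear-denominators)
open import Data.Integer using (+_)
open import Data.Rational using (_/_; _*_; _≥_)

theorem2p12 : (F G : Graph) (k : ℕ) → KFoldCover k G F →
    (Regular 3 F → fromℕ (γt G) ≥ (+ 3 / 5) * fromℕ k * fromℕ (γt F))
    × (Regular 4 F ⊎ Regular 5 F → fromℕ (γt G) ≥ (+ 1 / 2) * fromℕ k * fromℕ (γt F))
theorem2p12 F G k cover =
  let (cubic , quartic-or-quintic) = theorem-ℕ F G k cover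
  in (λ regular → clear-denominators 3 4 k (γt F) (γt G) (cubic regular))
   , (λ regular → clear-denominators 1 1 k (γt F) (γt G) (quartic-or-quintic regular))
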